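{- Let $\mathcal{L}:\sum_{i\in[k]}c_ix_i=0$ with $k\ge3$ and $c_1,\dots,c_k\in\mathbb{Z}\setminus\{0\}$ be non-degenerate, i.e. $\sum_{s\in S}c_s\ne0$ for every non-empty $S\subseteq[k]$. Then there exist $\beta>0$, $p_0>0$ and $C>0$ (depending on $\mathcal{L}$) such that for every prime $p>p_0$ there is a solution-free set $A\subseteq\mathbb{F}_p$ of $\mathcal{L}$ with $|A|\ge\beta p$ and $\alpha(\mathrm{Cay}_{\mathbb{F}_p}(A))\le C\frac{p}{\log p}$. In particular, $d(\mathcal{L},\varepsilon)\ge\beta>0$ for all $\varepsilon>0$.
   Context: For a prime $p$, a set $A\subseteq\mathbb{F}_p$ is solution-free for $\mathcal{L}$ if there is no $k$-tuple of pairwise distinct elements $a_1,\dots,a_k\in A$ with $\sum_i c_ia_i=0$ in $\mathbb{F}_p$. The Cayley graph $\mathrm{Cay}_{\mathbb{F}_p}(A)$ is the digraph on $\mathbb{F}_p$ with an arc $\vec{uv}$ iff $v-u\in A$; $\alpha$ of a digraph is the independence number of its underlying undirected graph. $D(\mathcal{L},\varepsilon,p)$ is the maximum size of a solution-free set $A$ of $\mathcal{L}$ in $\mathbb{F}_p$ with $\alpha(\mathrm{Cay}_{\mathbb{F}_p}(A))\le\varepsilon p$, and $d(\mathcal{L},\varepsilon):=\limsup_{p\to\infty,\ p\text{ prime}} D(\mathcal{L},\varepsilon,p)/p$. -}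

module Defs where

open import Data.Nat using (ℕ; zero; suc; _≤_; _<_; _*_)
open import Data.Nat.Primality using (Prime)
open import Data.Nat.Logarithm using (⌊log₂_⌋)
open import Data.Integer as ℤ using (ℤ; +_; _-_)
open import Data.Integer.Divisibility using () renaming (_∣_ to _∣ℤ_)
open import Data.Fin using (Fin; toℕ) renaming (zero to fzero; suc to fsuc)
open import Data.Fin.Subset using (Subset; _∈_; _∉_; ∣_∣; Nonempty)
open import Data.Product using (Σ; ∃; _×_)
open import Relation.Nullary using (¬_)
open import Relation.Binary.PropositionalEquality using (_≡_; _≢_)
open import Function.Definitions using (Injective)

∑ : (k : ℕ) → (Fin k → ℤ) → ℤ
∑ zero    f = + 0
∑ (suc k) f = f fzero ℤ.+ ∑ k (λ i → f (fsuc i))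

∑over : {k : ℕ} → Subset k → (Fin k → ℤ) → ℤ
∑over {k} S c = ∑ k (λ i → sel (Data.Vec.lookup S i) (c i))
  where
    open import Data.Bool using (Bool; true; false)
    import Data.Vec
    sel : Bool → ℤ → ℤ
    sel true  z = z
    sel false z = + 0

-- The linear equation L : Σ c_i x_i = 0 is given by its coefficient vector c : Fin k → ℤ.
-- Non-degenerate: every coefficient nonzero and Σ_{s∈S} c_s ≠ 0 for every non-empty S ⊆ [k].
NonDegenerate : {k : ℕ} → (Fin k → ℤ) → Set
NonDegenerate {k} c = ((i : Fin k) → c i ≢ + 0) × ((S : Subset k) → Nonempty S → ∑over S c ≢ + 0)

-- F_p is represented by Fin p (residues 0..p-1); x ≡ y in F_p iff p ∣ (x - y) in ℤ.
-- A ⊆ F_p is solution-free for L if there is no k-tuple of pairwise distinct a_i ∈ A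
-- with Σ c_i a_i = 0 in F_p.
SolutionFree : {k : ℕ} → (Fin k → ℤ) → (p : ℕ) → Subset p → Set
SolutionFree {k} c p A =
  ¬ (Σ (Fin k → Fin p) λ a →
       Injective _≡_ _≡_ a × ((i : Fin k) → a i ∈ A) ×
       ((+ p) ∣ℤ ∑ k (λ i → c i ℤ.* (+ toℕ (a i)))))

Arc : (p : ℕ) → Subset p → Fin p → Fin p → Set
Arc p A u v = ∃ λ a → a ∈ A × ((+ p) ∣ℤ ((+ toℕ v - + toℕ u) - + toℕ a))

-- Independent set in the underlying undirected (simple, loops ignored) graph of Cay(A).
Independent : (p : ℕ) → Subset p → Subset p → Set
Independent p A I = (u v : Fin p) → u ∈ I → v ∈ I → u ≢ v → ¬ Arc p A u v

-- "α(Cay_{F_p}(A)) · ⌊log₂ p⌋ ≤ C · p", i.e. every independent set I satisfies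
-- |I| · ⌊log₂ p⌋ ≤ C · p (equivalently α ≤ C p / log p, up to the constant C).
αCayLogBound : (p : ℕ) → Subset p → ℕ → Set
αCayLogBound p A C = (I : Subset p) → Independent p A I → ∣ I ∣ * ⌊log₂ p ⌋ ≤ C * p

{-# OPTIONS --safe #-}

-- Write W for Σ |cᵢ|, put w = W + 1 and M = w + 1, and choose n with Mⁿ⁺² ≤ p < Mⁿ⁺³.
-- Take for A the union of the blocks [w Mʲ, Mʲ⁺¹] = [Mʲ⁺¹ - Mʲ, Mʲ⁺¹], j ≤ n.
-- Solution-free: in Σ cᵢ aᵢ let J be the largest block index and S the set of i with aᵢ
-- in block J.  Up to an error at most W Mᴶ the sum is Mᴶ⁺¹ Σ_S cᵢ, which is non-zero; and
-- the sum is at most W Mⁿ⁺¹ < p in absolute value, so it does not vanish mod p either.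
-- Density: the block n alone has more than Mⁿ > p / M³ elements.
-- Independence: all differences Mʲ - Mⁱ with i < j ≤ n + 1 lie in A, so that the n + 2
-- translates I + Mʲ of an independent set I are disjoint, whence |I| (n + 2) ≤ p.
module Submission where

open import Defs
open import Data.Nat using (ℕ; _≤_; _<_; _*_; _≥_)
open import Data.Nat.Primality using (Prime)
open import Data.Nat.Logarithm using (⌊log₂_⌋)
open import Data.Integer using (ℤ)
open import Data.Fin using (Fin)
open import Data.Fin.Subset using (Subset; ∣_∣)
open import Data.Product using (Σ; ∃; _×_)

open import Data.Bool using (Bool; true; false; if_then_else_)
open import Data.Fin using (toℕ; fromℕ<; combine; remQuot) renaming (zero to fzero; suc to fsuc; _<_ to _<ᶠ_)
open import Data.Fin.Properties using (suc-injective; toℕ<n; toℕ-fromℕ<; toℕ-injective; fromℕ<-injective; injective⇒≤; combine-remQuot; <-cmp)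
open import Data.Fin.Subset using (inside; outside; _∈_)
import Data.Integer as ℤ
open import Data.Integer using (+_)
import Data.Integer.Properties as ℤ
open import Data.Integer.Tactic.RingSolver using (solve-∀)
open import Data.Nat using (zero; suc; _+_; _∸_; _^_; _⊔_; z≤n; s≤s; z<s; NonZero; _≟_; _≤?_; _<?_; >-nonZero; ≢-nonZero)
open import Data.Nat.Divisibility using (_∣_; ∣⇒≤; divides)
open import Data.Nat.DivMod using (_%_; _/_; m≡m%n+[m/n]*n; m%n<n)
open import Data.Nat.Logarithm using (⌊log₂⌋-mono-≤; ⌊log₂[2^n]⌋≡n)
open import Data.Nat.Properties hiding (_≟_; _≤?_; _<?_; <-cmp; suc-injective)
open import Data.Product using (_,_; proj₁; proj₂; uncurry)
open import Data.Vec using (_∷_; lookup; tabulate; here; there)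
open import Data.Vec.Properties using (lookup∘tabulate; lookup⇒[]=; []=⇒lookup)
open import Function.Definitions using (Injective)
open import Relation.Binary.Definitions using (tri<; tri≈; tri>)
open import Relation.Binary.PropositionalEquality using (_≡_; _≢_; refl; sym; trans; cong; cong₂; subst; module ≡-Reasoning)
open import Relation.Nullary using (yes; no; does; contradiction; _×-dec_)
open import Relation.Nullary.Decidable using (dec-true; dec-false)
open import Relation.Unary using (Decidable)

-- Finite sums of integers

‖_‖₁ : ∀ {k} → (Fin k → ℤ) → ℕ
‖_‖₁ {zero}  c = 0
‖_‖₁ {suc k} c = ℤ.∣ c fzero ∣ + ‖ (λ i → c (fsuc i)) ‖₁

∑-cong : ∀ k {f g : Fin k → ℤ} → (∀ i → f i ≡ g i) → ∑ k f ≡ ∑ k g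
∑-cong zero    f≗g = refl
∑-cong (suc k) f≗g = cong₂ ℤ._+_ (f≗g fzero) (∑-cong k (λ i → f≗g (fsuc i)))

∑-linear : ∀ k q (f g : Fin k → ℤ) → ∑ k (λ i → q ℤ.* f i ℤ.+ g i) ≡ q ℤ.* ∑ k f ℤ.+ ∑ k g
∑-linear zero    q f g = sym (trans (ℤ.+-identityʳ _) (ℤ.*-zeroʳ q))
∑-linear (suc k) q f g = trans
  (cong (λ s → (q ℤ.* f fzero ℤ.+ g fzero) ℤ.+ s) (∑-linear k q (λ i → f (fsuc i)) (λ i → g (fsuc i))))
  (regroup q _ _ _ _)
  where
  regroup : ∀ q a b s t → (q ℤ.* a ℤ.+ b) ℤ.+ (q ℤ.* s ℤ.+ t) ≡ q ℤ.* (a ℤ.+ s) ℤ.+ (b ℤ.+ t)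
  regroup = solve-∀

∣∑∣≤ : ∀ k (c r : Fin k → ℤ) B → (∀ i → ℤ.∣ r i ∣ ≤ B) →
       ℤ.∣ ∑ k (λ i → c i ℤ.* r i) ∣ ≤ ‖ c ‖₁ * B
∣∑∣≤ zero    c r B r≤B = z≤n
∣∑∣≤ (suc k) c r B r≤B = begin
  ℤ.∣ c₀ ℤ.* r₀ ℤ.+ rest ∣            ≤⟨ ℤ.∣i+j∣≤∣i∣+∣j∣ (c₀ ℤ.* r₀) rest ⟩
  ℤ.∣ c₀ ℤ.* r₀ ∣ + ℤ.∣ rest ∣        ≡⟨ cong (λ y → y + ℤ.∣ rest ∣) (ℤ.abs-* c₀ r₀) ⟩
  ℤ.∣ c₀ ∣ * ℤ.∣ r₀ ∣ + ℤ.∣ rest ∣    ≤⟨ +-mono-≤ (*-monoʳ-≤ ℤ.∣ c₀ ∣ (r≤B fzero)) (∣∑∣≤ k _ _ B (λ i → r≤B (fsuc i))) ⟩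
  ℤ.∣ c₀ ∣ * B + ‖ c′ ‖₁ * B          ≡⟨ *-distribʳ-+ B ℤ.∣ c₀ ∣ ‖ c′ ‖₁ ⟨
  (ℤ.∣ c₀ ∣ + ‖ c′ ‖₁) * B            ∎
  where
  open ≤-Reasoning
  c₀   = c fzero
  r₀   = r fzero
  c′   = λ i → c (fsuc i)
  rest = ∑ k (λ i → c (fsuc i) ℤ.* r (fsuc i))

∑over≡∑ : ∀ {k} (S : Subset k) c → ∑over S c ≡ ∑ k (λ i → if lookup S i then c i else + 0)
∑over≡∑ {k} S c = trans (proj₂ summand) (∑-cong k pointwise)
  where
  -- Recovers the summand of ∑over, which is local to Defs.
  summand : Σ (Fin k → ℤ) λ f → ∑over S c ≡ ∑ k f
  summand = _ , refl

  pointwise : ∀ i → proj₁ summand i ≡ (if lookup S i then c i else + 0)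
  pointwise i with lookup S i
  ... | true  = refl
  ... | false = refl

-- Congruences

∣i∣<p∧p∣i⇒i≡0 : ∀ {p} i → ℤ.∣ i ∣ < p → p ∣ ℤ.∣ i ∣ → i ≡ + 0
∣i∣<p∧p∣i⇒i≡0 i i<p p∣i with ℤ.∣ i ∣ ≟ 0
... | yes i≡0 = ℤ.∣i∣≡0⇒i≡0 i≡0
... | no  i≢0 = contradiction (∣⇒≤ {{≢-nonZero i≢0}} p∣i) (<⇒≱ i<p)

%-≡⇒∣- : ∀ p .{{_ : NonZero p}} m n → m % p ≡ n % p → p ∣ ℤ.∣ + n ℤ.- + m ∣
%-≡⇒∣- p m n eq = divides ℤ.∣ + (n / p) ℤ.- + (m / p) ∣ (begin
  ℤ.∣ + n ℤ.- + m ∣                                    ≡⟨ cong₂ (λ x y → ℤ.∣ x ℤ.- y ∣) (expand n) (expand m) ⟩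
  ℤ.∣ (+ (n % p) ℤ.+ + (n / p) ℤ.* + p) ℤ.- (+ (m % p) ℤ.+ + (m / p) ℤ.* + p) ∣
    ≡⟨ cong (λ r → ℤ.∣ (+ (n % p) ℤ.+ + (n / p) ℤ.* + p) ℤ.- (+ r ℤ.+ + (m / p) ℤ.* + p) ∣) eq ⟩
  ℤ.∣ (+ (n % p) ℤ.+ + (n / p) ℤ.* + p) ℤ.- (+ (n % p) ℤ.+ + (m / p) ℤ.* + p) ∣
    ≡⟨ cong ℤ.∣_∣ (cancel (+ (n % p)) (+ (n / p)) (+ (m / p)) (+ p)) ⟩
  ℤ.∣ (+ (n / p) ℤ.- + (m / p)) ℤ.* + p ∣              ≡⟨ ℤ.abs-* (+ (n / p) ℤ.- + (m / p)) (+ p) ⟩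
  ℤ.∣ + (n / p) ℤ.- + (m / p) ∣ * p                    ∎)
  where
  open ≡-Reasoning

  expand : ∀ x → + x ≡ + (x % p) ℤ.+ + (x / p) ℤ.* + p
  expand x = trans (cong +_ (m≡m%n+[m/n]*n x p)) (cong (λ y → + (x % p) ℤ.+ y) (ℤ.pos-* (x / p) p))

  cancel : ∀ r a b q → (r ℤ.+ a ℤ.* q) ℤ.- (r ℤ.+ b ℤ.* q) ≡ (a ℤ.- b) ℤ.* q
  cancel = solve-∀

∣-⇒≡ : ∀ {p} (u v : Fin p) → p ∣ ℤ.∣ + toℕ v ℤ.- + toℕ u ∣ → u ≡ v
∣-⇒≡ {p} u v p∣ = toℕ-injective (sym (ℤ.+-injective (ℤ.i-j≡0⇒i≡j _ _ (∣i∣<p∧p∣i⇒i≡0 _ small p∣))))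
  where
  open ≤-Reasoning
  small : ℤ.∣ + toℕ v ℤ.- + toℕ u ∣ < p
  small = begin-strict
    ℤ.∣ + toℕ v ℤ.- + toℕ u ∣  ≡⟨ cong ℤ.∣_∣ (ℤ.m-n≡m⊖n (toℕ v) (toℕ u)) ⟩
    ℤ.∣ toℕ v ℤ.⊖ toℕ u ∣      ≤⟨ ℤ.∣m⊝n∣≤m⊔n (toℕ v) (toℕ u) ⟩
    toℕ v ⊔ toℕ u              <⟨ ⊔-pres-<m (toℕ<n v) (toℕ<n u) ⟩
    p                          ∎

-- Subsets of Fin n

-- Lists the members of `S` by `Fin ∣ S ∣`, so that bounds on cardinalities reduce to injections
-- between finite types.
enumerate : ∀ {n} (S : Subset n) → Fin ∣ S ∣ → Fin n
enumerate (inside  ∷ S) fzero    = fzero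
enumerate (inside  ∷ S) (fsuc i) = fsuc (enumerate S i)
enumerate (outside ∷ S) i        = fsuc (enumerate S i)

enumerate-∈ : ∀ {n} (S : Subset n) i → enumerate S i ∈ S
enumerate-∈ (inside  ∷ S) fzero    = here
enumerate-∈ (inside  ∷ S) (fsuc i) = there (enumerate-∈ S i)
enumerate-∈ (outside ∷ S) i        = there (enumerate-∈ S i)

enumerate-injective : ∀ {n} (S : Subset n) → Injective _≡_ _≡_ (enumerate S)
enumerate-injective (inside  ∷ S) {fzero}  {fzero}  eq = refl
enumerate-injective (inside  ∷ S) {fsuc i} {fsuc j} eq =
  cong fsuc (enumerate-injective S (suc-injective eq))
enumerate-injective (outside ∷ S) eq = enumerate-injective S (suc-injective eq)

enumerate-surjective : ∀ {n} {S : Subset n} {x} → x ∈ S → ∃ λ i → enumerate S i ≡ x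
enumerate-surjective {S = inside ∷ S} here = fzero , refl
enumerate-surjective {S = inside ∷ S} (there x∈S) with i , refl ← enumerate-surjective x∈S = fsuc i , refl
enumerate-surjective {S = outside ∷ S} (there x∈S) with i , refl ← enumerate-surjective x∈S = i , refl

-- Inverting `enumerate S` on the values of `f` turns `f` into an injection from `Fin m` to
-- `Fin ∣ S ∣`.
injective⇒≤∣S∣ : ∀ {m n} (S : Subset n) (f : Fin m → Fin n) →
                 Injective _≡_ _≡_ f → (∀ i → f i ∈ S) → m ≤ ∣ S ∣
injective⇒≤∣S∣ S f f-inj f∈S = injective⇒≤ {f = λ i → proj₁ (index i)}
  (λ {i} {j} eq → f-inj (trans (sym (proj₂ (index i))) (trans (cong (enumerate S) eq) (proj₂ (index j)))))
  where
  index : ∀ i → ∃ λ s → enumerate S s ≡ f i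
  index i = enumerate-surjective (f∈S i)

separate : ∀ {n} {P : Fin n → Set} → Decidable P → Subset n
separate P? = tabulate (λ x → does (P? x))

separate⁺ : ∀ {n} {P : Fin n → Set} (P? : Decidable P) {x} → P x → x ∈ separate P?
separate⁺ P? {x} Px = lookup⇒[]= x _ (trans (lookup∘tabulate _ x) (dec-true (P? x) Px))

separate⁻ : ∀ {n} {P : Fin n → Set} (P? : Decidable P) {x} → x ∈ separate P? → P x
separate⁻ P? {x} x∈ with P? x | trans (sym (lookup∘tabulate (λ x → does (P? x)) x)) ([]=⇒lookup x∈)
... | yes Px | _ = Px

-- Two translates I + xᵢ and I + xⱼ of an independent set cannot meet when xⱼ - xᵢ ∈ A.
clique⇒independent-bound :
  ∀ {p m} .{{_ : NonZero p}} (A : Subset p) (x : Fin m → ℕ) →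
  (∀ i j → i <ᶠ j → ∃ λ a → a ∈ A × 0 < toℕ a × x i + toℕ a ≡ x j) →
  ∀ I → Independent p A I → ∣ I ∣ * m ≤ p
clique⇒independent-bound {p} {m} A x clique I indep = injective⇒≤ {f = translate} translate-injective
  where
  pt : Fin ∣ I ∣ → ℕ
  pt s = toℕ (enumerate I s)

  -- A number below `∣ I ∣ * m` codes a pair (point of `I`, index of a translate).
  translate : Fin (∣ I ∣ * m) → Fin p
  translate t with s , i ← remQuot {∣ I ∣} m t = fromℕ< (m%n<n (pt s + x i) p)

  no-collision : ∀ s s′ i j → i <ᶠ j → (pt s + x j) % p ≢ (pt s′ + x i) % p
  no-collision s s′ i j i<j eq with a , a∈A , 0<a , xi+a≡xj ← clique i j i<j =
    -- Substituting `x j = x i + a` in `u + x j ≡ v + x i` leaves `v - u ≡ a`, an arc from `u` to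
    -- `v`.
    indep u v (enumerate-∈ I s) (enumerate-∈ I s′) u≢v (a , a∈A , p∣v-u-a)
    where
    u = enumerate I s
    v = enumerate I s′

    rearrange : ∀ u v x a → (v ℤ.+ x) ℤ.- (u ℤ.+ (x ℤ.+ a)) ≡ (v ℤ.- u) ℤ.- a
    rearrange = solve-∀

    p∣v-u-a : p ∣ ℤ.∣ (+ toℕ v ℤ.- + toℕ u) ℤ.- + toℕ a ∣
    p∣v-u-a = subst (λ z → p ∣ ℤ.∣ z ∣)
      (trans (cong (λ y → (+ (toℕ v + x i)) ℤ.- + (toℕ u + y)) (sym xi+a≡xj))
             (rearrange (+ toℕ u) (+ toℕ v) (+ x i) (+ toℕ a)))
      (%-≡⇒∣- p (toℕ u + x j) (toℕ v + x i) eq)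

    u-u-a : ∀ u a → (u ℤ.- u) ℤ.- a ≡ ℤ.- a
    u-u-a = solve-∀

    -- `Independent` ignores loops, so `u ≡ v` has to be excluded: it would give `p ∣ a` although
    -- `0 < a < p`.
    u≢v : u ≢ v
    u≢v u≡v = contradiction (∣⇒≤ {{>-nonZero 0<a}} p∣a) (<⇒≱ (toℕ<n a))
      where
      p∣a : p ∣ toℕ a
      p∣a = subst (p ∣_)
        (trans (cong (λ w → ℤ.∣ (+ toℕ w ℤ.- + toℕ u) ℤ.- + toℕ a ∣) (sym u≡v))
          (trans (cong ℤ.∣_∣ (u-u-a (+ toℕ u) (+ toℕ a))) (ℤ.∣-i∣≡∣i∣ (+ toℕ a))))
        p∣v-u-a

  decompose : ∀ s s′ i j → (pt s + x i) % p ≡ (pt s′ + x j) % p → (s , i) ≡ (s′ , j)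
  decompose s s′ i j eq with <-cmp i j
  ... | tri< i<j _ _ = contradiction (sym eq) (no-collision s′ s i j i<j)
  ... | tri> _ _ j<i = contradiction eq (no-collision s s′ j i j<i)
  ... | tri≈ _ refl _ = cong (_, i) (enumerate-injective I (∣-⇒≡ _ _
        (subst (λ z → p ∣ ℤ.∣ z ∣) (cancel (+ pt s) (+ pt s′) (+ x i)) (%-≡⇒∣- p _ _ eq))))
    where
    cancel : ∀ u v x → (v ℤ.+ x) ℤ.- (u ℤ.+ x) ≡ v ℤ.- u
    cancel = solve-∀

  translate-injective : Injective _≡_ _≡_ translate
  translate-injective {t} {t′} eq = begin
    t                                      ≡⟨ combine-remQuot {∣ I ∣} m t ⟨
    uncurry combine (remQuot {∣ I ∣} m t)   ≡⟨ cong (uncurry combine) (decompose _ _ _ _ (fromℕ<-injective _ _ _ _ eq)) ⟩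
    uncurry combine (remQuot {∣ I ∣} m t′)  ≡⟨ combine-remQuot {∣ I ∣} m t′ ⟩
    t′                                     ∎
    where open ≡-Reasoning

-- Maxima and logarithms

argmax : ∀ {k} (e : Fin (suc k) → ℕ) → ∃ λ i → ∀ j → e j ≤ e i
argmax {zero} e = fzero , λ { fzero → ≤-refl }
argmax {suc k} e with i , max ← argmax (λ j → e (fsuc j)) | e fzero ≤? e (fsuc i)
... | yes e₀≤ = fsuc i , λ { fzero → e₀≤ ; (fsuc j) → max j }
... | no  e₀≰ = fzero , λ { fzero → ≤-refl ; (fsuc j) → ≤-trans (max j) (<⇒≤ (≰⇒> e₀≰)) }

floor-log : ∀ M → 1 < M → ∀ p → 0 < p → ∃ λ e → M ^ e ≤ p × p < M ^ suc e
floor-log M 1<M (suc zero) _ = 0 , ≤-refl , subst (1 <_) (sym (*-identityʳ M)) 1<M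
floor-log M 1<M (suc p@(suc _)) _ with e , lo , hi ← floor-log M 1<M p z<s | suc p <? M ^ suc e
... | yes p+1< = e , m≤n⇒m≤1+n lo , p+1<
-- Here `hi` reads `suc p ≤ M ^ suc e`, so the exponent grows by exactly one.
... | no  p+1≮ = suc e , ≮⇒≥ p+1≮ , ≤-<-trans hi (^-monoʳ-< M 1<M {suc e} ≤-refl)

m<2^m : ∀ m → m < 2 ^ m
m<2^m zero    = z<s
m<2^m (suc m) = +-mono-≤ (m^n>0 2 m) (subst (suc m ≤_) (sym (+-identityʳ _)) (m<2^m m))

-- Since `b < 2 ^ b`, the power `b ^ n` is at most `2 ^ (b * n)`; the loss of `b` against log `b`
-- only affects the constant.
m<b^n⇒⌊log₂m⌋≤b*n : ∀ {m} b n → m < b ^ n → ⌊log₂ m ⌋ ≤ b * n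
m<b^n⇒⌊log₂m⌋≤b*n {m} b n m<b^n = begin
  ⌊log₂ m ⌋              ≤⟨ ⌊log₂⌋-mono-≤ (≤-trans (<⇒≤ m<b^n) (^-monoˡ-≤ n (<⇒≤ (m<2^m b)))) ⟩
  ⌊log₂ ((2 ^ b) ^ n) ⌋  ≡⟨ cong ⌊log₂_⌋ (^-*-assoc 2 b n) ⟩
  ⌊log₂ (2 ^ (b * n)) ⌋  ≡⟨ ⌊log₂[2^n]⌋≡n (b * n) ⟩
  b * n                  ∎
  where open ≤-Reasoning

-- The union of blocks

module Blocks (w : ℕ) where

  M : ℕ
  M = suc w

  -- The lower endpoint has to be included: it is the difference of the consecutive powers
  -- `M ^ suc j` and `M ^ j`.
  InBlock : ℕ → ℕ → Set
  InBlock x j = w * M ^ j ≤ x × x ≤ M ^ suc j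

  SomeBlock : ℕ → ℕ → Set
  SomeBlock n x = ∃ λ j → j < suc n × InBlock x j

  someBlock? : ∀ n → Decidable (SomeBlock n)
  someBlock? n x = anyUpTo? (λ j → (w * M ^ j ≤? x) ×-dec (x ≤? M ^ suc j)) (suc n)

  blocks : ∀ n p → Subset p
  blocks n p = separate {p} (λ x → someBlock? n (toℕ x))

  -- Replace each `a i` by `Q` if it lies in the top block `J` and by 0 otherwise. This changes it
  -- by at most `M ^ J`, hence the sum by less than `Q`, while the replaced sum is a non-zero
  -- multiple of `Q`.
  ∑-nonzero : ∀ {k} (c : Fin (suc k) → ℤ) → NonDegenerate c → ‖ c ‖₁ < M →
              (a e : Fin (suc k) → ℕ) → (∀ i → InBlock (a i) (e i)) →
              ∑ (suc k) (λ i → c i ℤ.* + a i) ≢ + 0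
  ∑-nonzero {k} c (_ , nondeg) ‖c‖<M a e a∈e ∑≡0 = <⇒≱ error<main main≤error
    where
    open ≤-Reasoning
    top = argmax e
    J   = e (proj₁ top)
    Q   = M ^ suc J

    S : Subset (suc k)
    S = separate (λ i → e i ≟ J)

    -- The Boolean is a separate argument so that each case of `e i ≟ J` can be substituted into
    -- `r i` by `dec-true` or `dec-false`.
    remainder : Bool → Fin (suc k) → ℤ
    remainder b i = + a i ℤ.- (if b then + Q else + 0)

    r : Fin (suc k) → ℤ
    r i = remainder (does (e i ≟ J)) i

    main error : ℤ
    main  = + Q ℤ.* ∑over S c
    error = ∑ (suc k) (λ i → c i ℤ.* r i)

    split : ∑ (suc k) (λ i → c i ℤ.* + a i) ≡ main ℤ.+ error
    split = trans (∑-cong (suc k) pointwise)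
      (trans (∑-linear (suc k) (+ Q) (λ i → if lookup S i then c i else + 0) (λ i → c i ℤ.* r i))
             (cong (λ s → + Q ℤ.* s ℤ.+ error) (sym (∑over≡∑ S c))))
      where
      in-top : ∀ q c a → c ℤ.* a ≡ q ℤ.* c ℤ.+ c ℤ.* (a ℤ.- q)
      in-top = solve-∀
      below : ∀ q c a → c ℤ.* a ≡ q ℤ.* + 0 ℤ.+ c ℤ.* (a ℤ.- + 0)
      below = solve-∀
      pointwise : ∀ i → c i ℤ.* + a i ≡ + Q ℤ.* (if lookup S i then c i else + 0) ℤ.+ c i ℤ.* r i
      pointwise i rewrite lookup∘tabulate (λ i → does (e i ≟ J)) i with does (e i ≟ J)
      ... | true  = in-top (+ Q) (c i) (+ a i)
      ... | false = below (+ Q) (c i) (+ a i)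

    r≤ : ∀ i → ℤ.∣ r i ∣ ≤ M ^ J
    r≤ i with e i ≟ J
    ... | yes ei≡J = subst (λ b → ℤ.∣ remainder b i ∣ ≤ M ^ J) (sym (dec-true (e i ≟ J) ei≡J)) (begin
      ℤ.∣ + a i ℤ.- + Q ∣      ≡⟨ cong ℤ.∣_∣ (ℤ.m-n≡m⊖n (a i) Q) ⟩
      ℤ.∣ a i ℤ.⊖ Q ∣          ≡⟨ ℤ.∣⊖∣-≤ (subst (λ j → a i ≤ M ^ suc j) ei≡J (proj₂ (a∈e i))) ⟩
      Q ∸ a i                  ≤⟨ ∸-monoʳ-≤ Q (subst (λ j → w * M ^ j ≤ a i) ei≡J (proj₁ (a∈e i))) ⟩
      -- `Q` unfolds to `M ^ J + w * M ^ J`.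
      Q ∸ w * M ^ J            ≡⟨ m+n∸n≡m (M ^ J) (w * M ^ J) ⟩
      M ^ J                    ∎)
    ... | no ei≢J = subst (λ b → ℤ.∣ remainder b i ∣ ≤ M ^ J) (sym (dec-false (e i ≟ J) ei≢J)) (begin
      ℤ.∣ + a i ℤ.- + 0 ∣      ≡⟨ cong ℤ.∣_∣ (ℤ.+-identityʳ (+ a i)) ⟩
      a i                      ≤⟨ proj₂ (a∈e i) ⟩
      M ^ suc (e i)            ≤⟨ ^-monoʳ-≤ M (≤∧≢⇒< (proj₂ top i) ei≢J) ⟩
      M ^ J                    ∎)

    error<main : ℤ.∣ error ∣ < ℤ.∣ main ∣
    error<main = begin-strict
      ℤ.∣ error ∣              ≤⟨ ∣∑∣≤ (suc k) c r (M ^ J) r≤ ⟩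
      ‖ c ‖₁ * M ^ J           <⟨ *-monoˡ-< (M ^ J) {{m^n≢0 M J}} ‖c‖<M ⟩
      Q                        ≤⟨ m≤m*n Q ℤ.∣ ∑over S c ∣ {{≢-nonZero λ z → nondeg S S-nonempty (ℤ.∣i∣≡0⇒i≡0 z)}} ⟩
      Q * ℤ.∣ ∑over S c ∣      ≡⟨ ℤ.abs-* (+ Q) (∑over S c) ⟨
      ℤ.∣ main ∣               ∎
      where
      -- The index at which the maximum `J` is attained lies in `S`.
      S-nonempty = proj₁ top , separate⁺ (λ i → e i ≟ J) {proj₁ top} refl

    main≤error : ℤ.∣ main ∣ ≤ ℤ.∣ error ∣
    main≤error = ≤-reflexive (trans (cong ℤ.∣_∣ (cancel main error (trans (sym split) ∑≡0))) (ℤ.∣-i∣≡∣i∣ error))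
      where
      m≡m+e-e : ∀ m e → m ≡ (m ℤ.+ e) ℤ.- e
      m≡m+e-e = solve-∀
      cancel : ∀ m e → m ℤ.+ e ≡ + 0 → m ≡ ℤ.- e
      cancel m e eq = trans (m≡m+e-e m e) (trans (cong (ℤ._- e) eq) (ℤ.+-identityˡ (ℤ.- e)))

  -- There is no wrap-around: the sum is smaller than `p` in absolute value, so divisibility by `p`
  -- would make it zero in the integers.
  blocks-solutionFree : ∀ {k} (c : Fin (suc k) → ℤ) → NonDegenerate c → ‖ c ‖₁ < M →
                        ∀ {n p} → M ^ (2 + n) ≤ p → SolutionFree c p (blocks n p)
  blocks-solutionFree {k} c nondeg ‖c‖<M {n} {p} lo (a , _ , a∈ , p∣∑) =
    ∑-nonzero c nondeg ‖c‖<M (λ i → toℕ (a i)) (λ i → proj₁ (block i)) (λ i → proj₂ (proj₂ (block i)))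
      (∣i∣<p∧p∣i⇒i≡0 _ small p∣∑)
    where
    open ≤-Reasoning
    block : ∀ i → SomeBlock n (toℕ (a i))
    block i = separate⁻ (λ x → someBlock? n (toℕ x)) (a∈ i)

    a≤ : ∀ i → toℕ (a i) ≤ M ^ suc n
    a≤ i with j , j≤n , _ , a≤M^j ← block i = ≤-trans a≤M^j (^-monoʳ-≤ M j≤n)

    small : ℤ.∣ ∑ (suc k) (λ i → c i ℤ.* + toℕ (a i)) ∣ < p
    small = begin-strict
      ℤ.∣ ∑ (suc k) (λ i → c i ℤ.* + toℕ (a i)) ∣  ≤⟨ ∣∑∣≤ (suc k) c (λ i → + toℕ (a i)) (M ^ suc n) a≤ ⟩
      ‖ c ‖₁ * M ^ suc n                           <⟨ *-monoˡ-< (M ^ suc n) {{m^n≢0 M (suc n)}} ‖c‖<M ⟩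
      M ^ (2 + n)                                  ≤⟨ lo ⟩
      p                                            ∎

  blocks-dense : ∀ {n p} → M ^ suc n < p → M ^ n ≤ ∣ blocks n p ∣
  blocks-dense {n} {p} hi = injective⇒≤∣S∣ (blocks n p) shift shift-injective shift∈
    where
    bound : ∀ (t : Fin (M ^ n)) → toℕ t + w * M ^ n ≤ M ^ suc n
    bound t = +-monoˡ-≤ (w * M ^ n) (<⇒≤ (toℕ<n t))

    -- Block `n` starts at `w * M ^ n` and has length `M ^ n`.
    shift : Fin (M ^ n) → Fin p
    shift t = fromℕ< (≤-<-trans (bound t) hi)

    shift-injective : Injective _≡_ _≡_ shift
    shift-injective eq = toℕ-injective (+-cancelʳ-≡ (w * M ^ n) _ _ (fromℕ<-injective _ _ _ _ eq))

    shift∈ : ∀ t → shift t ∈ blocks n p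
    shift∈ t = separate⁺ (λ x → someBlock? n (toℕ x)) (subst (SomeBlock n) (sym (toℕ-fromℕ< _))
      (n , ≤-refl , m≤n+m _ (toℕ t) , bound t))

  -- For `i ≤ j` the difference of `M ^ suc j` and `M ^ i` is at most `M ^ suc j` and at least
  -- `M ^ suc j ∸ M ^ j`, which is `w * M ^ j`; so it lies in block `j`.
  blocks-clique : 0 < w → ∀ {n p} → M ^ suc n < p → (i j : Fin (2 + n)) → i <ᶠ j →
                  ∃ λ a → a ∈ blocks n p × 0 < toℕ a × M ^ toℕ i + toℕ a ≡ M ^ toℕ j
  -- The larger index is a successor, and its predecessor `j` is the index of the block.
  blocks-clique 0<w {n} {p} hi i (fsuc j) (s≤s i≤j) =
    fromℕ< d<p ,
    separate⁺ (λ x → someBlock? n (toℕ x)) (subst (SomeBlock n) (sym toℕ≡d)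
      (toℕ j , toℕ<n j , lower , m∸n≤m _ (M ^ toℕ i))) ,
    subst (0 <_) (sym toℕ≡d) (<-≤-trans (*-mono-< 0<w (m^n>0 M (toℕ j))) lower) ,
    trans (cong (λ y → M ^ toℕ i + y) toℕ≡d) (m+[n∸m]≡n (≤-trans M^i≤M^j (m≤m+n _ (w * M ^ toℕ j))))
    where
    d = M ^ suc (toℕ j) ∸ M ^ toℕ i

    d<p : d < p
    d<p = ≤-<-trans (m∸n≤m _ (M ^ toℕ i)) (≤-<-trans (^-monoʳ-≤ M (toℕ<n j)) hi)

    toℕ≡d : toℕ (fromℕ< d<p) ≡ d
    toℕ≡d = toℕ-fromℕ< d<p

    M^i≤M^j : M ^ toℕ i ≤ M ^ toℕ j
    M^i≤M^j = ^-monoʳ-≤ M i≤j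

    lower : w * M ^ toℕ j ≤ d
    lower = m+n≤o⇒m≤o∸n (w * M ^ toℕ j)
      (subst (_≤ M ^ suc (toℕ j)) (+-comm (M ^ toℕ i) _) (+-monoˡ-≤ (w * M ^ toℕ j) M^i≤M^j))

  blocks-logBound : 0 < w → ∀ {n p} → .{{_ : NonZero p}} → M ^ suc n < p → p < M ^ (3 + n) →
                    αCayLogBound p (blocks n p) (M + M)
  blocks-logBound 0<w {n} {p} lo hi I indep = begin
    ∣ I ∣ * ⌊log₂ p ⌋              ≤⟨ *-monoʳ-≤ ∣ I ∣ (m<b^n⇒⌊log₂m⌋≤b*n M (3 + n) hi) ⟩
    -- `3 + n ≤ m + m` makes the number `m` of translates a factor; the 2 enters the constant
    -- `M + M`.
    ∣ I ∣ * (M * (3 + n))          ≤⟨ *-monoʳ-≤ ∣ I ∣ (*-monoʳ-≤ M (+-mono-≤ (s≤s (z≤n {suc n})) (≤-refl {2 + n}))) ⟩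
    ∣ I ∣ * (M * (m + m))          ≡⟨ cong (∣ I ∣ *_) (trans (*-distribˡ-+ M m m) (sym (*-distribʳ-+ m M M))) ⟩
    ∣ I ∣ * ((M + M) * m)          ≡⟨ x∙yz≈y∙xz ∣ I ∣ (M + M) m ⟩
    (M + M) * (∣ I ∣ * m)          ≤⟨ *-monoʳ-≤ (M + M) (clique⇒independent-bound (blocks n p) (λ i → M ^ toℕ i) (blocks-clique 0<w lo) I indep) ⟩
    (M + M) * p                    ∎
    where
    open ≤-Reasoning
    open import Algebra.Properties.CommutativeSemigroup *-commutativeSemigroup using (x∙yz≈y∙xz)
    m = 2 + n

-- Choice of the constants

theorem3p3 : (k : ℕ) → k ≥ 3 → (c : Fin k → ℤ) → NonDegenerate c →
    Σ ℕ λ b → 1 ≤ b × Σ ℕ λ p₀ → Σ ℕ λ C →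
    ((p : ℕ) → Prime p → p₀ < p →
    Σ (Subset p) λ A →
    SolutionFree c p A × (p ≤ b * ∣ A ∣) ×
    αCayLogBound p A C)
-- The factor `M ^ 3` compares `p < M ^ (3 + n)` with the `M ^ n` elements of block `n`; the
-- threshold `M ^ 2` guarantees an exponent of at least 2 in `floor-log`.
theorem3p3 (suc k) _ c nondeg = M ^ 3 , m^n>0 M 3 , M ^ 2 , M + M , construct
  where
  w = suc ‖ c ‖₁
  open Blocks w

  1<M : 1 < M
  1<M = s≤s z<s

  construct : ∀ p → Prime p → M ^ 2 < p → Σ (Subset p) λ A →
              SolutionFree c p A × (p ≤ M ^ 3 * ∣ A ∣) × αCayLogBound p A (M + M)
  construct p _ M²<p with floor-log M 1<M p (≤-trans z<s M²<p)
  ... | 0 , _ , hi = contradiction M²<p (<⇒≯ (<-≤-trans hi (^-monoʳ-≤ M {1} {2} (s≤s z≤n))))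
  ... | 1 , _ , hi = contradiction M²<p (<⇒≯ hi)
  ... | suc (suc n) , lo , hi =
    blocks n p ,
    blocks-solutionFree c nondeg (m≤n⇒m≤1+n ≤-refl) {n} lo ,
    ≤-trans (subst (p ≤_) (^-distribˡ-+-* M 3 n) (<⇒≤ hi)) (*-monoʳ-≤ (M ^ 3) (blocks-dense {n} M^[n+1]<p)) ,
    blocks-logBound z<s {n} {{>-nonZero (≤-trans z<s M²<p)}} M^[n+1]<p hi
    where
    M^[n+1]<p : M ^ suc n < p
    M^[n+1]<p = <-≤-trans (^-monoʳ-< M 1<M {suc n} ≤-refl) lo
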